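{- Let $q=2$, let $d\ge 1$ be an integer and let $j$ be an integer with $(d+1)/2 \le j \le d$. Then: (i) $K_j(1) \le K_j(i)$ for all integers $i$ with $0 \le i \le d-1$. (ii) $K_j(1) \le K_j(d)$ if and only if $j$ is even or $j = d$.
   Context: For $q=2$, $d \ge 1$ and $0\le i,j\le d$, $$K_j(i) = \sum_{h=0}^j (-1)^h \binom{i}{h} \binom{d-i}{j-h}.$$ These are the eigenvalues of the graph $H(d,2,j)$ on the binary vectors of length $d$, two vectors being adjacent when they differ in exactly $j$ coordinates. -}

module Defs where

open import Data.Fin.Base using (toℕ)
open import Data.Integer.Base using (ℤ; +_; -1ℤ; _*_; _^_)
open import Data.Integer.Properties using (+-*-semiring)
open import Data.Nat.Base using (ℕ; _∸_)
open import Data.Nat.Combinatorics using (_C_)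
open import Algebra.Properties.Semiring.Sum +-*-semiring using (sum⁺-syntax)

-- K d j i is the binary Krawtchouk value K_j(i) for word length d, with i ≤ d
-- and j ≤ d; the truncated subtractions are then exact.
K : ℕ → ℕ → ℕ → ℤ
K d j i = ∑[ h ≤ j ]
  (-1ℤ ^ toℕ h * + (i C toℕ h) * + ((d ∸ i) C (j ∸ toℕ h)))

{-# OPTIONS --safe #-}
-- K_j(i) is the coefficient of x^j in (1 - x)^i (1 + x)^(d-i). Removing one factor
-- 1 ± x from this polynomial for 1 ≤ i ≤ d - 1 gives K^d_j(i) = K^{d-1}_j(i′) ± K^{d-1}_{j-1}(i′)
-- with 1 ≤ i′ ≤ d - 2, whereas K^d_j(1) = K^{d-1}_j(1) + K^{d-1}_{j-1}(1), so |K^d_j(i)| ≤ -K^d_j(1)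
-- follows by induction on d. The index j - 1 drops out of the range only when
-- 2(j - 1) = d - 1, and then the coefficient is the middle one, which is 0 when i′ is odd
-- by the symmetry K_j(i) = (-1)^i K_{d-j}(i); i′ can be made odd by choosing which
-- factor to remove.
module Submission where

open import Defs
open import Data.Integer.Base using () renaming (_≤_ to _≤ℤ_)
open import Data.Nat.Base using (ℕ; _+_; _*_; _∸_; _≤_)
open import Data.Nat.Divisibility using (_∣_)
open import Data.Product.Base using (_×_)
open import Data.Sum.Base using (_⊎_)
open import Function.Bundles using (_⇔_)
open import Relation.Binary.PropositionalEquality.Core using (_≡_)

open import Data.Empty using (⊥-elim)
open import Data.Fin.Base using (toℕ)
open import Data.Integer.Base as ℤ using (ℤ; +_; 0ℤ; 1ℤ; -1ℤ)
import Data.Integer.Properties as ℤ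
open import Data.Integer.Tactic.RingSolver using (solve-∀)
open import Data.Nat.Base using (zero; suc; z≤n; s≤s; s≤s⁻¹; _<_)
open import Data.Nat.Combinatorics using (_C_; nCk+nC[k+1]≡[n+1]C[k+1])
open import Data.Nat.Divisibility using (divides)
import Data.Nat.Properties as ℕ
open import Data.Product.Base using (_,_; proj₁)
open import Data.Sum.Base using (inj₁; inj₂)
open import Function.Base using (_∘_)
open import Function.Bundles using (mk⇔)
open import Relation.Binary.PropositionalEquality.Core using (refl; sym; trans; cong; cong₂; subst; subst₂)
open import Relation.Nullary.Negation using (¬_)

open import Algebra.Properties.Semiring.Sum ℤ.+-*-semiring using (sum⁺-syntax)

-- Convolution and factors 1 ± x

conv : (ℕ → ℤ) → (ℕ → ℤ) → ℕ → ℤ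
conv f g j = ∑[ h ≤ j ] (f (toℕ h) ℤ.* g (j ∸ toℕ h))

conv-zeroˡ : ∀ {f} g → (∀ n → f n ≡ 0ℤ) → ∀ j → conv f g j ≡ 0ℤ
conv-zeroˡ g eq zero rewrite eq 0 = refl
conv-zeroˡ {f} g eq (suc j) rewrite eq 0 | conv-zeroˡ {f ∘ suc} g (eq ∘ suc) j = refl

conv-distribʳ-minus : ∀ f f₁ f₂ g → (∀ n → f n ≡ f₁ n ℤ.- f₂ n) →
  ∀ j → conv f g j ≡ conv f₁ g j ℤ.- conv f₂ g j
conv-distribʳ-minus f f₁ f₂ g eq zero rewrite eq 0 = ring (f₁ 0) (f₂ 0) (g 0)
  where
  ring : ∀ x y z → (x ℤ.- y) ℤ.* z ℤ.+ 0ℤ ≡ (x ℤ.* z ℤ.+ 0ℤ) ℤ.- (y ℤ.* z ℤ.+ 0ℤ)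
  ring = solve-∀
conv-distribʳ-minus f f₁ f₂ g eq (suc j) =
  trans (cong₂ (λ x y → x ℤ.* g (suc j) ℤ.+ y) (eq 0)
               (conv-distribʳ-minus (f ∘ suc) (f₁ ∘ suc) (f₂ ∘ suc) g (eq ∘ suc) j))
        (ring (f₁ 0) (f₂ 0) (g (suc j)) (conv (f₁ ∘ suc) g j) (conv (f₂ ∘ suc) g j))
  where
  ring : ∀ x y z u v →
    (x ℤ.- y) ℤ.* z ℤ.+ (u ℤ.- v) ≡ (x ℤ.* z ℤ.+ u) ℤ.- (y ℤ.* z ℤ.+ v)
  ring = solve-∀

-- Sequences are read as generating functions: f′ = (1 - x) f, and below g′ = (1 + x) g.
conv-1-xˡ : ∀ f f′ g → f′ 0 ≡ f 0 → (∀ n → f′ (suc n) ≡ f (suc n) ℤ.- f n) →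
  ∀ j → conv f′ g (suc j) ≡ conv f g (suc j) ℤ.- conv f g j
conv-1-xˡ f f′ g eq₀ eq j =
  trans (cong₂ (λ x y → x ℤ.* g (suc j) ℤ.+ y) eq₀
               (conv-distribʳ-minus (f′ ∘ suc) (f ∘ suc) f g eq j))
        (sym (ℤ.+-assoc (f 0 ℤ.* g (suc j)) (conv (f ∘ suc) g j) (ℤ.- conv f g j)))

conv-1+xʳ : ∀ f g g′ → g′ 0 ≡ g 0 → (∀ n → g′ (suc n) ≡ g (suc n) ℤ.+ g n) →
  ∀ j → conv f g′ (suc j) ≡ conv f g (suc j) ℤ.+ conv f g j
conv-1+xʳ f g g′ eq₀ eq zero rewrite eq 0 | eq₀ = ring (f 0) (f 1) (g 0) (g 1)
  where
  ring : ∀ x y z u → x ℤ.* (u ℤ.+ z) ℤ.+ (y ℤ.* z ℤ.+ 0ℤ)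
    ≡ (x ℤ.* u ℤ.+ (y ℤ.* z ℤ.+ 0ℤ)) ℤ.+ (x ℤ.* z ℤ.+ 0ℤ)
  ring = solve-∀
conv-1+xʳ f g g′ eq₀ eq (suc j) =
  trans (cong₂ (λ x y → f 0 ℤ.* x ℤ.+ y) (eq (suc j)) (conv-1+xʳ (f ∘ suc) g g′ eq₀ eq j))
        (ring (f 0) (g (suc (suc j))) (g (suc j)) (conv (f ∘ suc) g (suc j)) (conv (f ∘ suc) g j))
  where
  ring : ∀ x y z u v → x ℤ.* (y ℤ.+ z) ℤ.+ (u ℤ.+ v) ≡ (x ℤ.* y ℤ.+ u) ℤ.+ (x ℤ.* z ℤ.+ v)
  ring = solve-∀

-- Signs and parity

sgn : ℕ → ℤ
sgn n = -1ℤ ℤ.^ n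

sgn≡±1 : ∀ n → sgn n ≡ 1ℤ ⊎ sgn n ≡ -1ℤ
sgn≡±1 zero = inj₁ refl
sgn≡±1 (suc n) with sgn≡±1 n
... | inj₁ eq = inj₂ (cong (-1ℤ ℤ.*_) eq)
... | inj₂ eq = inj₁ (cong (-1ℤ ℤ.*_) eq)

sgn-2+ : ∀ n → sgn (2 + n) ≡ sgn n
sgn-2+ n = ring (sgn n)
  where
  ring : ∀ x → -1ℤ ℤ.* (-1ℤ ℤ.* x) ≡ x
  ring = solve-∀

sgn-suc⁻¹ : ∀ n → sgn (suc n) ≡ -1ℤ → sgn n ≡ 1ℤ
sgn-suc⁻¹ n eq = trans (sym (sgn-2+ n)) (cong (-1ℤ ℤ.*_) eq)

sgn-double : ∀ n → sgn (n + n) ≡ 1ℤ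
sgn-double zero = refl
sgn-double (suc n) rewrite ℕ.+-suc n n = trans (sgn-2+ (n + n)) (sgn-double n)

sgn≡1⇒2∣ : ∀ n → sgn n ≡ 1ℤ → 2 ∣ n
sgn≡1⇒2∣ zero _ = divides 0 refl
sgn≡1⇒2∣ (suc (suc n)) eq with sgn≡1⇒2∣ n (trans (sym (sgn-2+ n)) eq)
... | divides q eq′ = divides (suc q) (cong (λ m → 2 + m) eq′)

2∣⇒sgn≡1 : ∀ {n} → 2 ∣ n → sgn n ≡ 1ℤ
2∣⇒sgn≡1 (divides q refl) rewrite ℕ.*-comm q 2 | ℕ.+-identityʳ q = sgn-double q

-- Krawtchouk coefficients: recurrences and symmetries

-- The coefficient of x^j in (1 - x)^a (1 + x)^b; thus K d j i = coeff i (d ∸ i) j.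
coeff : ℕ → ℕ → ℕ → ℤ
coeff a b = conv (λ h → sgn h ℤ.* + (a C h)) (λ n → + (b C n))

pascal : ∀ n k → suc n C suc k ≡ n C suc k + n C k
pascal n k = trans (sym (nCk+nC[k+1]≡[n+1]C[k+1] n k)) (ℕ.+-comm (n C k) (n C suc k))

coeff-1+x : ∀ a b j → coeff a (suc b) (suc j) ≡ coeff a b (suc j) ℤ.+ coeff a b j
coeff-1+x a b = conv-1+xʳ (λ h → sgn h ℤ.* + (a C h)) (λ n → + (b C n)) (λ n → + (suc b C n))
  refl (λ n → cong +_ (pascal b n))

coeff-1-x : ∀ a b j → coeff (suc a) b (suc j) ≡ coeff a b (suc j) ℤ.- coeff a b j
coeff-1-x a b = conv-1-xˡ (λ h → sgn h ℤ.* + (a C h)) (λ h → sgn h ℤ.* + (suc a C h))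
  (λ n → + (b C n)) refl
  (λ n → trans (cong (λ z → sgn (suc n) ℤ.* + z) (pascal a n))
               (ring (sgn n) (+ (a C suc n)) (+ (a C n))))
  where
  ring : ∀ s x y → -1ℤ ℤ.* s ℤ.* (x ℤ.+ y) ≡ -1ℤ ℤ.* s ℤ.* x ℤ.- s ℤ.* y
  ring = solve-∀

-- The polynomial (1 - x)^a (1 + x)^b has degree `a + b`.
coeff-vanish : ∀ a b {k} → a + b < k → coeff a b k ≡ 0ℤ
coeff-vanish zero zero {suc k} _ =
  trans (ℤ.+-identityˡ _)
        (conv-zeroˡ {λ h → sgn (suc h) ℤ.* + (0 C suc h)} (λ n → + (0 C n))
                    (λ n → ℤ.*-zeroʳ (sgn (suc n))) k)
coeff-vanish (suc a) zero {suc k} (s≤s p) =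
  trans (coeff-1-x a 0 k)
        (cong₂ ℤ._-_ (coeff-vanish a 0 (ℕ.m≤n⇒m≤1+n p)) (coeff-vanish a 0 p))
coeff-vanish a (suc b) {suc k} p with subst (_≤ k) (ℕ.+-suc a b) (s≤s⁻¹ p)
... | q = trans (coeff-1+x a b k)
                (cong₂ ℤ._+_ (coeff-vanish a b (ℕ.m≤n⇒m≤1+n q)) (coeff-vanish a b q))

-- Multiplication by x. The value 0 at index 0 extends both recurrences to `j = 0`.
shift : (ℕ → ℤ) → ℕ → ℤ
shift f zero    = 0ℤ
shift f (suc n) = f n

coeff-1+x-shift : ∀ a b j → coeff a (suc b) j ≡ coeff a b j ℤ.+ shift (coeff a b) j
coeff-1+x-shift a b zero    = refl
coeff-1+x-shift a b (suc j) = coeff-1+x a b j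

coeff-1-x-shift : ∀ a b j → coeff (suc a) b j ≡ coeff a b j ℤ.- shift (coeff a b) j
coeff-1-x-shift a b zero    = refl
coeff-1-x-shift a b (suc j) = coeff-1-x a b j

mutual
  -- Substituting 1/x for x and multiplying by x^(a+b) turns (1 - x)^a (1 + x)^b into (-1)^a times
  -- itself. In the induction the two terms of the recurrence trade places, hence the two shifted
  -- forms.
  coeff-reflect : ∀ a b k l → k + l ≡ a + b → coeff a b k ≡ sgn a ℤ.* coeff a b l
  coeff-reflect zero zero zero zero _ = refl
  coeff-reflect (suc a) zero k l eq
    rewrite coeff-1-x-shift a 0 k | coeff-1-x-shift a 0 l
          | coeff-reflect-shiftˡ a 0 k l eq | coeff-reflect-shiftʳ a 0 k l eq =
    ring (sgn a) (coeff a 0 l) (shift (coeff a 0) l)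
    where
    ring : ∀ s x y → s ℤ.* y ℤ.- s ℤ.* x ≡ -1ℤ ℤ.* s ℤ.* (x ℤ.- y)
    ring = solve-∀
  coeff-reflect a (suc b) k l eq
    rewrite coeff-1+x-shift a b k | coeff-1+x-shift a b l
          | coeff-reflect-shiftˡ a b k l (trans eq (ℕ.+-suc a b))
          | coeff-reflect-shiftʳ a b k l (trans eq (ℕ.+-suc a b)) =
    ring (sgn a) (coeff a b l) (shift (coeff a b) l)
    where
    ring : ∀ s x y → s ℤ.* y ℤ.+ s ℤ.* x ≡ s ℤ.* (x ℤ.+ y)
    ring = solve-∀

  coeff-reflect-shiftˡ : ∀ a b k l → k + l ≡ suc (a + b) →
    shift (coeff a b) k ≡ sgn a ℤ.* coeff a b l
  -- Here `l` is `a + b + 1`, beyond the degree, so both sides are 0.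
  coeff-reflect-shiftˡ a b zero l eq
    rewrite coeff-vanish a b (ℕ.≤-reflexive (sym eq)) = sym (ℤ.*-zeroʳ (sgn a))
  coeff-reflect-shiftˡ a b (suc k) l eq = coeff-reflect a b k l (ℕ.suc-injective eq)

  coeff-reflect-shiftʳ : ∀ a b k l → k + l ≡ suc (a + b) →
    coeff a b k ≡ sgn a ℤ.* shift (coeff a b) l
  coeff-reflect-shiftʳ a b k zero eq =
    trans (coeff-vanish a b (ℕ.≤-reflexive (sym (trans (sym (ℕ.+-identityʳ k)) eq))))
          (sym (ℤ.*-zeroʳ (sgn a)))
  coeff-reflect-shiftʳ a b k (suc l) eq =
    coeff-reflect a b k l (ℕ.suc-injective (trans (sym (ℕ.+-suc k l)) eq))

-- The middle index is its own mirror image, so the coefficient equals its negative.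
coeff-middle : ∀ a b j → sgn a ≡ -1ℤ → j + j ≡ a + b → coeff a b j ≡ 0ℤ
coeff-middle a b j odd eq =
  x≡-1*x⇒x≡0 (coeff a b j) (trans (coeff-reflect a b j j eq) (cong (ℤ._* coeff a b j) odd))
  where
  x≡-1*x⇒x≡0 : ∀ x → x ≡ -1ℤ ℤ.* x → x ≡ 0ℤ
  x≡-1*x⇒x≡0 (+ zero) _ = refl

-- Substituting -x for x turns (1 - x)^d into (1 + x)^d.
coeff-flip : ∀ d j → coeff d 0 j ≡ sgn j ℤ.* coeff 0 d j
coeff-flip zero zero = refl
coeff-flip zero (suc j) rewrite coeff-vanish 0 0 (s≤s (z≤n {j})) = sym (ℤ.*-zeroʳ (sgn (suc j)))
coeff-flip (suc d) zero = refl
coeff-flip (suc d) (suc j)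
  rewrite coeff-1-x d 0 j | coeff-1+x 0 d j | coeff-flip d (suc j) | coeff-flip d j =
  ring (sgn j) (coeff 0 d (suc j)) (coeff 0 d j)
  where
  ring : ∀ s x y → -1ℤ ℤ.* s ℤ.* x ℤ.- s ℤ.* y ≡ -1ℤ ℤ.* s ℤ.* (x ℤ.+ y)
  ring = solve-∀

-- Positivity of the coefficients of (1 + x)^b

coeff₀-nonneg : ∀ b j → 0ℤ ≤ℤ coeff 0 b j
coeff₀-nonneg b zero = ℤ.+≤+ z≤n
coeff₀-nonneg zero (suc j) = ℤ.≤-reflexive (sym (coeff-vanish 0 0 (s≤s (z≤n {j}))))
coeff₀-nonneg (suc b) (suc j) rewrite coeff-1+x 0 b j =
  ℤ.+-mono-≤ (coeff₀-nonneg b (suc j)) (coeff₀-nonneg b j)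

coeff₀-pos : ∀ b j → j ≤ b → 1ℤ ≤ℤ coeff 0 b j
coeff₀-pos b zero _ = ℤ.≤-refl
coeff₀-pos (suc b) (suc j) (s≤s j≤b) rewrite coeff-1+x 0 b j =
  ℤ.+-mono-≤ (coeff₀-nonneg b (suc j)) (coeff₀-pos b j j≤b)

-- The two polynomials are (1 + x)^n ∓ x (1 + x)^n, and the second term has nonnegative
-- coefficients. This settles i = 0 in (i) and even j in (ii).
coeff₁≤coeff₀ : ∀ n j → coeff 1 n (suc j) ≤ℤ coeff 0 (suc n) (suc j)
coeff₁≤coeff₀ n j rewrite coeff-1-x 0 n j | coeff-1+x 0 n j =
  ℤ.+-monoʳ-≤ (coeff 0 n (suc j)) (ℤ.≤-trans (ℤ.neg-mono-≤ 0≤y) 0≤y)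
  where
  0≤y = coeff₀-nonneg n j

-- The bound on absolute values

infix 4 _≤±_

-- Amounts to |y| ≤ -x. Invariance under negating `y` is what allows a factor 1 - x to be removed.
_≤±_ : ℤ → ℤ → Set
x ≤± y = x ≤ℤ y × x ≤ℤ ℤ.- y

≤±-+ : ∀ {x y x′ y′} → x ≤± y → x′ ≤± y′ → x ℤ.+ x′ ≤± y ℤ.+ y′
≤±-+ {y = y} {y′ = y′} (p , q) (p′ , q′) =
  ℤ.+-mono-≤ p p′ ,
  subst (_ ≤ℤ_) (sym (ℤ.neg-distrib-+ y y′)) (ℤ.+-mono-≤ q q′)

≤±-neg : ∀ {x y} → x ≤± y → x ≤± ℤ.- y
≤±-neg {x} {y} (p , q) = q , subst (x ≤ℤ_) (sym (ℤ.neg-involutive y)) p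

≤±-1+x : ∀ a b j →
  coeff 1 (suc (a + b)) (suc j) ≤± coeff (suc a) (suc b) (suc j) →
  coeff 1 (suc (a + b)) j ≤± coeff (suc a) (suc b) j →
  coeff 1 (suc (a + suc b)) (suc j) ≤± coeff (suc a) (suc (suc b)) (suc j)
≤±-1+x a b j p q
  rewrite ℕ.+-suc a b | coeff-1+x 1 (suc (a + b)) j | coeff-1+x (suc a) (suc b) j = ≤±-+ p q

-- The left side still loses a factor 1 + x, although the right side loses 1 - x.
≤±-1-x : ∀ a b j →
  coeff 1 (suc (a + b)) (suc j) ≤± coeff (suc a) (suc b) (suc j) →
  coeff 1 (suc (a + b)) j ≤± coeff (suc a) (suc b) j →
  coeff 1 (suc (suc a + b)) (suc j) ≤± coeff (suc (suc a)) (suc b) (suc j)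
≤±-1-x a b j p q
  rewrite coeff-1+x 1 (suc (a + b)) j | coeff-1-x (suc a) (suc b) j = ≤±-+ p (≤±-neg q)

halve-≤ : ∀ {m} j → suc (suc m) ≤ suc j + suc j → m ≤ j + j
halve-≤ {m} j p = s≤s⁻¹ (subst (suc m ≤_) (ℕ.+-suc j j) (s≤s⁻¹ p))

mutual
  -- With d = a + b + 2, this adds the boundary case 2j = d. There `j` is the middle index, and both
  -- polynomials have an odd number of factors 1 - x, so both coefficients are 0.
  coeff₁-≤±-odd : ∀ a b j → sgn a ≡ 1ℤ → 2 + (a + b) ≤ j + j →
    coeff 1 (suc (a + b)) j ≤± coeff (suc a) (suc b) j
  coeff₁-≤±-odd a b j even p with ℕ.m≤n⇒m<n∨m≡n p
  ... | inj₁ p′ = coeff₁-≤± a b j p′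
  ... | inj₂ eq
    rewrite coeff-middle 1 (suc (a + b)) j refl (sym eq)
          | coeff-middle (suc a) (suc b) j (cong (-1ℤ ℤ.*_) even)
                         (trans (sym eq) (cong suc (sym (ℕ.+-suc a b)))) =
    ℤ.≤-refl , ℤ.≤-refl

  -- Here i = a + 1 and d - i = b + 1, so that 1 ≤ i ≤ d - 1 is built in and the hypothesis reads d
  -- + 1 ≤ 2j.
  coeff₁-≤± : ∀ a b j → 3 + (a + b) ≤ j + j →
    coeff 1 (suc (a + b)) j ≤± coeff (suc a) (suc b) j
  coeff₁-≤± a b (suc j) p with sgn≡±1 a
  coeff₁-≤± a (suc b) (suc j) p | inj₁ even =
    ≤±-1+x a b j (coeff₁-≤± a b (suc j) (ℕ.<⇒≤ p′)) (coeff₁-≤±-odd a b j even (halve-≤ j p′))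
    where
    p′ : 4 + (a + b) ≤ suc j + suc j
    p′ = subst (λ m → 3 + m ≤ suc j + suc j) (ℕ.+-suc a b) p
  coeff₁-≤± (suc a) b (suc j) p | inj₂ odd =
    ≤±-1-x a b j (coeff₁-≤± a b (suc j) (ℕ.<⇒≤ p))
                 (coeff₁-≤±-odd a b j (sgn-suc⁻¹ a odd) (halve-≤ j p))
  -- The single factor 1 + x must stay, so the new i is even. But d is then even, so twice the
  -- lowered index cannot equal d - 1 and the strict bound holds.
  coeff₁-≤± (suc a) zero (suc j) p | inj₁ even =
    ≤±-1-x a 0 j (coeff₁-≤± a 0 (suc j) (ℕ.<⇒≤ p)) (coeff₁-≤± a 0 j (ℕ.≤∧≢⇒< (halve-≤ j p) ≢))
    where
    ≢ : ¬ 2 + (a + 0) ≡ j + j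
    ≢ eq with trans (sym (sgn-double j))
                (trans (cong sgn (trans (sym eq) (cong (λ m → 2 + m) (ℕ.+-identityʳ a))))
                       (cong (-1ℤ ℤ.*_) even))
    ... | ()
  -- Both sides come from 1 - x^2: index 1 is out of range, index 2 gives -1, higher ones give 0.
  coeff₁-≤± zero zero (suc zero) (s≤s (s≤s ())) | inj₁ _
  coeff₁-≤± zero zero (suc (suc zero)) p | inj₁ _ = ℤ.≤-refl , ℤ.-≤+
  coeff₁-≤± zero zero (suc (suc (suc j))) p | inj₁ _
    rewrite coeff-vanish 1 1 (s≤s (s≤s (s≤s (z≤n {j})))) = ℤ.≤-refl , ℤ.≤-refl

-- The two claims

K₁≤K : ∀ n j → n + 2 ≤ suc j + suc j → ∀ i → i ≤ n → K (suc n) (suc j) 1 ≤ℤ K (suc n) (suc j) i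
K₁≤K n j p zero _ = coeff₁≤coeff₀ n j
K₁≤K n j p (suc a) a<n with ℕ.m≤n⇒∃[o]m+o≡n a<n
... | b , refl = subst (λ m → coeff 1 (suc (a + b)) (suc j) ≤ℤ coeff (suc a) m (suc j))
  (sym (trans (cong (_∸ a) (sym (ℕ.+-suc a b))) (ℕ.m+n∸m≡n a (suc b))))
  (proj₁ (coeff₁-≤± a b (suc j) (subst (_≤ suc j + suc j) (ℕ.+-comm (suc (a + b)) 2) p)))

-- For odd j < d, with x and y the coefficients of (1 + x)^(d-1) at j and j - 1, the inequality
-- reads x - y ≤ -(x + y). Hence x ≤ -x, although x ≥ 1.
K₁≤K-top⇒ : ∀ n j → suc j ≤ suc n → coeff 1 n (suc j) ≤ℤ coeff (suc n) 0 (suc j) →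
  2 ∣ suc j ⊎ suc j ≡ suc n
K₁≤K-top⇒ n j j≤n p with sgn≡±1 (suc j) | ℕ.m≤n⇒m<n∨m≡n j≤n
... | inj₁ even | _       = inj₁ (sgn≡1⇒2∣ (suc j) even)
... | inj₂ _   | inj₂ eq = inj₂ eq
... | inj₂ odd | inj₁ (s≤s j<n) = ⊥-elim (x≰-x (coeff₀-pos n (suc j) j<n) x≤-x)
  where
  x = coeff 0 n (suc j)
  y = coeff 0 n j
  ring₁ : ∀ x y → (x ℤ.- y) ℤ.+ y ≡ x
  ring₁ = solve-∀
  ring₂ : ∀ x y → -1ℤ ℤ.* (x ℤ.+ y) ℤ.+ y ≡ ℤ.- x
  ring₂ = solve-∀
  top : coeff (suc n) 0 (suc j) ≡ -1ℤ ℤ.* (x ℤ.+ y)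
  top = trans (coeff-flip (suc n) (suc j)) (cong₂ ℤ._*_ odd (coeff-1+x 0 n j))
  x≤-x : x ≤ℤ ℤ.- x
  x≤-x = subst₂ _≤ℤ_ (ring₁ x y) (ring₂ x y)
    (ℤ.+-monoˡ-≤ y (subst₂ _≤ℤ_ (coeff-1-x 0 n j) top p))
  x≰-x : ∀ {z} → 1ℤ ≤ℤ z → ¬ z ≤ℤ ℤ.- z
  x≰-x 1≤z z≤-z with ℤ.≤-trans 1≤z (ℤ.≤-trans z≤-z (ℤ.neg-mono-≤ 1≤z))
  ... | ()

K₁≤K-top⇐ : ∀ n j → 2 ∣ suc j ⊎ suc j ≡ suc n → coeff 1 n (suc j) ≤ℤ coeff (suc n) 0 (suc j)
K₁≤K-top⇐ n j (inj₁ 2∣j) = subst (coeff 1 n (suc j) ≤ℤ_) (sym top) (coeff₁≤coeff₀ n j)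
  where
  top : coeff (suc n) 0 (suc j) ≡ coeff 0 (suc n) (suc j)
  top = trans (coeff-flip (suc n) (suc j))
              (trans (cong (ℤ._* coeff 0 (suc n) (suc j)) (2∣⇒sgn≡1 2∣j)) (ℤ.*-identityˡ _))
-- Reflection moves index d to 0, where both coefficients are 1; what remains is -1 ≤ (-1)^d.
K₁≤K-top⇐ n j (inj₂ refl)
  rewrite coeff-reflect 1 n (suc n) 0 (ℕ.+-identityʳ (suc n))
        | coeff-reflect (suc n) 0 (suc n) 0 refl with sgn≡±1 (suc n)
... | inj₁ eq rewrite eq = ℤ.-≤+
... | inj₂ eq rewrite eq = ℤ.≤-refl

corollary1p3 : (d j : ℕ) → 1 ≤ d → d + 1 ≤ 2 * j → j ≤ d →
    ((i : ℕ) → i ≤ d ∸ 1 → K d j 1 ≤ℤ K d j i)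
    × ((K d j 1 ≤ℤ K d j d) ⇔ (2 ∣ j ⊎ j ≡ d))
corollary1p3 (suc n) (suc j) _ p j≤d =
  K₁≤K n j (subst₂ _≤_ (sym (ℕ.+-suc n 1)) (cong (λ m → suc j + m) (ℕ.+-identityʳ (suc j))) p) ,
  -- At i = d the exponent of 1 + x is `n ∸ n`, which does not reduce to 0 for a variable `n`.
  subst (λ m → (coeff 1 n (suc j) ≤ℤ coeff (suc n) m (suc j)) ⇔ (2 ∣ suc j ⊎ suc j ≡ suc n))
        (sym (ℕ.n∸n≡0 n)) (mk⇔ (K₁≤K-top⇒ n j j≤d) (K₁≤K-top⇐ n j))
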